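{- Let $(\mathcal F,\preceq)$ be an intersection system on the finite set $N$ and let $v:\mathcal F\to\mathbb R_+$ be a supermodular capacity on $(\mathcal F,\preceq)$. Then for all $f\in\mathbb R^N_+$, $$\int_{\mathcal F} f\,dv=\max\Big\{\sum_{F\in\mathcal F}y_Fv(F)\;\Big|\; y\in\mathbb R^{\mathcal F}_+,\ \sum_{F\in\mathcal F}y_F\mathbf 1_F\le f\Big\}.$$ Hence $f\mapsto\int_{\mathcal F} f\,dv$ is a positively homogeneous and superadditive functional on $\mathbb R^N_+$.
   Context: An ordered system is a pair $(\mathcal F,\preceq)$ with $\mathcal F$ a family of non-empty subsets of a finite set $N$ covering $N$ and $\preceq$ a partial order on $\mathcal F$; index $\mathcal F=\{F_1,\dots,F_m\}$ so that $F_i\succeq F_j$ implies $i\le j$. For $X\subseteq N$ let $\mathcal F(X)=\{F\in\mathcal F\mid F\subseteq X\}$ and $\mathcal F_0(X)=\mathcal F(X)\cup\{\emptyset\}$. The system is consecutive if $F\cap H\subseteq G$ whenever $F\preceq G\preceq H$. A consecutive ordered system is an intersection system if for every $F\in\mathcal F$: (IS0) for every $G\in\mathcal F$ with $F\cap G\ne\emptyset$ there is some $F\vee G\in\mathcal F(F\cup G)$ with $F,G\preceq F\vee G$; (IS1) for all $G,H\in[F)=\{G\in\mathcal F\mid G\succeq F\}$ there exist $G\vee H,G\wedge H\in\mathcal F(G\cup H)$ with $F\preceq G\wedge H\preceq G,H\preceq G\vee H$. A capacity is a valuation $v:\mathcal F\to\mathbb R_+$ with $v(F)\le v(G)$ whenever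 $F\preceq G$. Extend $\preceq$ to $\mathcal F\cup\{\emptyset\}$ with $\emptyset$ the unique minimum, and set $v(\emptyset)=0$. $F_i,F_j$ are co-intersecting if there is $k\le\min\{i,j\}$ with $F_k\cap F_i\ne\emptyset$ and $F_k\cap F_j\ne\emptyset$. $v$ is supermodular if for all co-intersecting $F,G\in\mathcal F$ there exist $F\wedge G,F\vee G\in\mathcal F_0(F\cup G)$ with $F\wedge G\preceq F,G\preceq F\vee G$ and $v(F\wedge G)+v(F\vee G)\ge v(F)+v(G)$. Simple functions: for $F\in\mathcal F$, $\zeta^F(G)=1$ iff $G\succeq F$, else $0$; each valuation has a unique expansion $v=\sum_F\beta_F\zeta^F$. For a belief function ($\beta_F\ge0$ for all $F$) and $f\in\mathbb R^N_+$: $\int_{\mathcal F} f\,dv:=\min\{\langle f,x\rangle\mid x\in\mathbb R^N_+,\ x(G)\ge v(G)\ \forall G\in\mathcal F\}$ with $x(G)=\sum_{i\in G}x_i$; for general $v$, $\int_{\mathcal F} f\,dv:=\int_{\mathcal F} f\,dv^+-\int_{\mathcal F} f\,dv^-$ where $v^+=\sum_{\beta_F\ge0}\beta_F\zeta^F$, $v^-=\sum_{\beta_F\le0}(-\beta_F)\zeta^F$. -}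

module Defs where

open import Data.Nat using (ℕ; zero; suc) renaming (_≤_ to _≤ℕ_)
open import Data.Fin using (Fin; toℕ) renaming (zero to fz; suc to fs)
open import Data.Bool using (Bool; true; false; if_then_else_; _∨_)
open import Data.Maybe using (Maybe; just; nothing)
open import Data.Product using (Σ; ∃; _×_; _,_)
open import Data.Sum using (_⊎_; inj₁; inj₂; [_,_])
open import Data.Unit using (⊤)
open import Data.Empty using (⊥)
open import Relation.Nullary using (¬_)
open import Relation.Binary.PropositionalEquality using (_≡_)
open import Relation.Binary.Structures using (IsTotalOrder)
open import Algebra.Structures using (IsCommutativeRing)

record OrderedField : Set₁ where
  infixl 6 _+_
  infixl 7 _*_
  infix 4 _≤_
  field
    K      : Set
    0# 1#  : K
    _+_ _*_ : K → K → K
    -_     : K → K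
    _≤_    : K → K → Set
    isCommutativeRing : IsCommutativeRing _≡_ _+_ _*_ -_ 0# 1#
    0≢1    : ¬ (0# ≡ 1#)
    inverse : ∀ x → ¬ (x ≡ 0#) → Σ K λ y → x * y ≡ 1#
    isTotalOrder : IsTotalOrder _≡_ _≤_
    +-mono-≤ : ∀ {x y} z → x ≤ y → x + z ≤ y + z
    *-nonneg : ∀ {x y} → 0# ≤ x → 0# ≤ y → 0# ≤ x * y

  total : ∀ x y → x ≤ y ⊎ y ≤ x
  total = IsTotalOrder.total isTotalOrder

  _<_ : K → K → Set
  x < y = x ≤ y × ¬ (x ≡ y)

-- Ordered systems on N = Fin n with family F = {F_0,…,F_{m-1}}.
-- Subsets of N are Bool-valued predicates; F_i ≼ F_j iff le i j ≡ true.

Sub : ℕ → Set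
Sub n = Fin n → Bool

_⊆_ : ∀ {n} → Sub n → Sub n → Set
A ⊆ B = ∀ a → A a ≡ true → B a ≡ true

_∪_ : ∀ {n} → Sub n → Sub n → Sub n
(A ∪ B) a = A a ∨ B a

Meets : ∀ {n} → Sub n → Sub n → Set
Meets A B = ∃ λ a → A a ≡ true × B a ≡ true

emptySub : ∀ {n} → Sub n
emptySub _ = false

record OrderedSystem (n m : ℕ) : Set where
  field
    set : Fin m → Sub n
    le  : Fin m → Fin m → Bool
    nonempty : ∀ i → ∃ λ a → set i a ≡ true
    covers   : ∀ a → ∃ λ i → set i a ≡ true
    distinct : ∀ i j → (∀ a → set i a ≡ set j a) → i ≡ j
    ≼-refl    : ∀ i → le i i ≡ true
    ≼-antisym : ∀ i j → le i j ≡ true → le j i ≡ true → i ≡ j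
    ≼-trans   : ∀ i j k → le i j ≡ true → le j k ≡ true → le i k ≡ true
    indexing  : ∀ i j → le j i ≡ true → toℕ i ≤ℕ toℕ j

  _≼_ : Fin m → Fin m → Set
  i ≼ j = le i j ≡ true

  -- F ∪ {∅}: nothing stands for ∅, the unique minimum
  set₀ : Maybe (Fin m) → Sub n
  set₀ nothing  = emptySub
  set₀ (just i) = set i

  _≼₀_ : Maybe (Fin m) → Maybe (Fin m) → Set
  nothing ≼₀ _      = ⊤
  just i  ≼₀ nothing = ⊥
  just i  ≼₀ just j  = i ≼ j

module _ {n m : ℕ} (S : OrderedSystem n m) where
  open OrderedSystem S

  Consecutive : Set
  Consecutive = ∀ f g h → f ≼ g → g ≼ h →
    (λ a → if set f a then set h a else false) ⊆ set g

  IS0 : Set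
  IS0 = ∀ f g → Meets (set f) (set g) →
    Σ (Fin m) λ j → set j ⊆ (set f ∪ set g) × f ≼ j × g ≼ j

  IS1 : Set
  IS1 = ∀ f g h → f ≼ g → f ≼ h →
    Σ (Fin m) λ jn → Σ (Fin m) λ mt →
      set jn ⊆ (set g ∪ set h) × set mt ⊆ (set g ∪ set h) ×
      f ≼ mt × mt ≼ g × mt ≼ h × g ≼ jn × h ≼ jn

  IntersectionSystem : Set
  IntersectionSystem = Consecutive × IS0 × IS1

  CoIntersecting : Fin m → Fin m → Set
  CoIntersecting i j = Σ (Fin m) λ k →
    toℕ k ≤ℕ toℕ i × toℕ k ≤ℕ toℕ j × Meets (set k) (set i) × Meets (set k) (set j)

module _ (𝕂 : OrderedField) where
  open OrderedField 𝕂

  sumF : ∀ {k} → (Fin k → K) → K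
  sumF {zero}  _ = 0#
  sumF {suc k} g = g fz + sumF (λ i → g (fs i))

  posPart negPart : K → K
  posPart x = [ (λ _ → x) , (λ _ → 0#) ] (total 0# x)
  negPart x = [ (λ _ → 0#) , (λ _ → - x) ] (total 0# x)

  Nonneg : ∀ {k} → (Fin k → K) → Set
  Nonneg g = ∀ i → 0# ≤ g i

  module _ {n m : ℕ} (S : OrderedSystem n m) where
    open OrderedSystem S

    Capacity : (Fin m → K) → Set
    Capacity v = Nonneg v × (∀ i j → i ≼ j → v i ≤ v j)

    val₀ : (Fin m → K) → Maybe (Fin m) → K
    val₀ v nothing  = 0#
    val₀ v (just i) = v i

    Supermodular : (Fin m → K) → Set
    Supermodular v = ∀ i j → CoIntersecting S i j →
      Σ (Maybe (Fin m)) λ A → Σ (Maybe (Fin m)) λ B →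
        set₀ A ⊆ (set i ∪ set j) × set₀ B ⊆ (set i ∪ set j) ×
        A ≼₀ just i × A ≼₀ just j × just i ≼₀ B × just j ≼₀ B ×
        v i + v j ≤ val₀ v A + val₀ v B

    -- ζ^F(G) = 1 iff F ≼ G ; expansion v = Σ_F β_F ζ^F
    simpleSum : (Fin m → K) → Fin m → K
    simpleSum β g = sumF (λ f → if le f g then β f else 0#)

    IsMobius : (Fin m → K) → (Fin m → K) → Set
    IsMobius v β = ∀ g → v g ≡ simpleSum β g

    measure : (Fin n → K) → Fin m → K
    measure x g = sumF (λ a → if set g a then x a else 0#)

    inner : (Fin n → K) → (Fin n → K) → K
    inner f x = sumF (λ a → f a * x a)

    PrimalFeasible : (Fin m → K) → (Fin n → K) → Set
    PrimalFeasible w x = Nonneg x × (∀ g → w g ≤ measure x g)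

    IsMinLP : (Fin m → K) → (Fin n → K) → K → Set
    IsMinLP w f c =
      (Σ (Fin n → K) λ x → PrimalFeasible w x × inner f x ≡ c) ×
      (∀ x → PrimalFeasible w x → c ≤ inner f x)

    IsIntegral : (Fin m → K) → (Fin n → K) → K → Set
    IsIntegral v f I = Σ (Fin m → K) λ β → IsMobius v β ×
      Σ K λ c⁺ → Σ K λ c⁻ →
        IsMinLP (simpleSum (λ F → posPart (β F))) f c⁺ ×
        IsMinLP (simpleSum (λ F → negPart (β F))) f c⁻ ×
        I ≡ c⁺ + - c⁻

    DualFeasible : (Fin n → K) → (Fin m → K) → Set
    DualFeasible f y = Nonneg y ×
      (∀ a → sumF (λ g → if set g a then y g else 0#) ≤ f a)

    IsMaxLP : (Fin m → K) → (Fin n → K) → K → Set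
    IsMaxLP v f c =
      (Σ (Fin m → K) λ y → DualFeasible f y × sumF (λ g → y g * v g) ≡ c) ×
      (∀ y → DualFeasible f y → sumF (λ g → y g * v g) ≤ c)

{-# OPTIONS --safe #-}
module Submission where

open import Defs
open import Algebra.Bundles using (CommutativeRing)
open import Data.Bool using (Bool; true; false; if_then_else_; _∧_; not)
open import Data.Bool.Properties as Bool using (¬-not)
open import Data.Fin using (Fin; toℕ; zero; suc)
open import Data.Fin.Properties using (_≟_; toℕ-injective; toℕ<n; any?; all?)
open import Data.List using (filter; allFin)
open import Data.List.Membership.Propositional.Properties using (∈-filter⁺; ∈-allFin)
open import Data.List.Relation.Unary.All using (lookup)
open import Data.List.Relation.Unary.All.Properties using (all-filter)
open import Data.Maybe using (just; nothing)
open import Data.Nat as ℕ using (ℕ)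
import Data.Nat.Properties as ℕ
open import Data.Product using (Σ; ∃; _×_; _,_; proj₁; proj₂)
open import Data.Sum using (_⊎_; inj₁; inj₂)
open import Data.Unit using (tt)
open import Function using (_∘_)
open import Level using (0ℓ)
open import Relation.Binary.Bundles using (TotalOrder)
open import Relation.Binary.PropositionalEquality using (_≡_; _≢_; refl; sym; trans; cong; cong₂; subst)
open import Relation.Binary.Structures using (IsTotalOrder)
open import Relation.Nullary using (¬_; Dec; yes; no; does; contradiction)
open import Relation.Nullary.Decidable using (_→-dec_)
open import Relation.Unary using (Decidable)
import Algebra.Properties.CommutativeMonoid.Sum as CommutativeMonoidSum
import Algebra.Properties.Ring as RingProperties
import Algebra.Properties.Semiring.Sum as SemiringSum
import Algebra.Solver.Ring.NaturalCoefficients.Default as NaturalCoefficients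
import Data.List.Extrema as Extrema
import Relation.Binary.Reasoning.PartialOrder as PartialOrderReasoning

-- The greedy (Monge) algorithm repeatedly takes the first set M inside the set X
-- of remaining points (a ≼-maximal one, by the indexing), charges it
-- the least remaining weight c(p) over p ∈ M, and deletes p from X. The charges y form a
-- feasible dual solution. Solving x(M) = w(M) for the chosen M backwards gives x
-- with ⟨f,x⟩ = ⟨y,w⟩, and uncrossing shows that x is feasible whenever w is a
-- supermodular capacity. Neither the choices nor y depend on w; since the existence of joins
-- for v makes every multiple b ζ^F with b ≥ 0 supermodular, the same y is optimal for v⁺, v⁻ and v.

-- Minima over finite index sets and inclusions of finite subsets.

module _ (O : TotalOrder 0ℓ 0ℓ 0ℓ) where
  open TotalOrder O using (Carrier; _≤_)
  open Extrema O using (argmin; argmin-all; f[argmin]≤f[xs])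

  minimal-element : ∀ {k} {P : Fin k → Set} → Decidable P → (h : Fin k → Carrier) → ∃ P →
    ∃ λ i → P i × (∀ j → P j → h i ≤ h j)
  minimal-element {k} P? h (i , Pi) =
    argmin h i candidates , argmin-all h Pi (all-filter P? (allFin k)) ,
    λ j Pj → lookup (f[argmin]≤f[xs] i candidates) (∈-filter⁺ P? (∈-allFin j) Pj)
    where candidates = filter P? (allFin k)

true≢false : ∀ {b} → b ≡ true → b ≡ false → ∀ {A : Set} → A
true≢false refl ()

infixl 6 _∖_
_∖_ : ∀ {n} → Sub n → Fin n → Sub n
(X ∖ p) a = X a ∧ not (does (a ≟ p))

∖-⊆ : ∀ {n} (X : Sub n) p → (X ∖ p) ⊆ X
∖-⊆ X p a h with X a
... | true = refl

p∉∖ : ∀ {n} (X : Sub n) p → (X ∖ p) p ≡ false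
p∉∖ X p with p ≟ p
... | yes _  = Bool.∧-zeroʳ (X p)
... | no p≢p = contradiction refl p≢p

⊆-∖ : ∀ {n} {A X : Sub n} {p} → A ⊆ X → A p ≡ false → A ⊆ (X ∖ p)
⊆-∖ {p = p} A⊆X p∉A a a∈A with a ≟ p
... | yes refl = true≢false a∈A p∉A
... | no _     rewrite A⊆X a a∈A = refl

∉-of-⊆∖ : ∀ {n} {A : Sub n} (X : Sub n) p → A ⊆ (X ∖ p) → A p ≡ false
∉-of-⊆∖ {A = A} X p A⊆ with A p in eq
... | false = refl
... | true  = true≢false (A⊆ p eq) (p∉∖ X p)

⊆-trans : ∀ {n} {A B C : Sub n} → A ⊆ B → B ⊆ C → A ⊆ C
⊆-trans A⊆B B⊆C a = B⊆C a ∘ A⊆B a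

∪-⊆ : ∀ {n} {A B C : Sub n} → A ⊆ C → B ⊆ C → (A ∪ B) ⊆ C
∪-⊆ {A = A} A⊆C B⊆C a a∈ with A a in eq
... | true  = A⊆C a eq
... | false = B⊆C a a∈

⊆∪ : ∀ {n} {A B C D : Sub n} → D ⊆ (A ∪ B) → A ⊆ C → B ⊆ C → D ⊆ C
⊆∪ D⊆ A⊆C B⊆C = ⊆-trans D⊆ (∪-⊆ A⊆C B⊆C)

-- Ordered-field arithmetic and finite sums.

module Arithmetic (𝕂 : OrderedField) where
  open OrderedField 𝕂 public renaming (+-mono-≤ to +-monoˡ-≤)
  open IsTotalOrder isTotalOrder public using ()
    renaming (refl to ≤-refl; trans to ≤-trans; antisym to ≤-antisym; reflexive to ≤-reflexive)

  commutativeRing : CommutativeRing 0ℓ 0ℓ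
  commutativeRing = record { isCommutativeRing = isCommutativeRing }

  totalOrder : TotalOrder 0ℓ 0ℓ 0ℓ
  totalOrder = record { isTotalOrder = isTotalOrder }

  open CommutativeRing commutativeRing public
    using (+-comm; +-assoc; +-identityˡ; +-identityʳ; -‿inverseˡ; -‿inverseʳ;
           *-comm; *-assoc; *-identityˡ; zeroˡ; zeroʳ; distribˡ; distribʳ)
  open NaturalCoefficients (CommutativeRing.commutativeSemiring commutativeRing) public
    using (solve; _:=_; _:+_; _:*_)
  open CommutativeMonoidSum (CommutativeRing.+-commutativeMonoid commutativeRing)
    using (sum; ∑-distrib-+; ∑-comm)
  open SemiringSum (CommutativeRing.semiring commutativeRing)
    using (*-distribˡ-sum)
  open RingProperties (CommutativeRing.ring commutativeRing) public using (-‿distribʳ-*)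
  open PartialOrderReasoning (TotalOrder.poset totalOrder) public
    using (begin_; begin-equality_; step-≤; step-≡-⟩; step-≡-⟨; _∎)

  x-y+y≡x : ∀ x y → x + - y + y ≡ x
  x-y+y≡x x y = trans (+-assoc x (- y) y) (trans (cong (x +_) (-‿inverseˡ y)) (+-identityʳ x))

  x+y-y≡x : ∀ x y → x + y + - y ≡ x
  x+y-y≡x x y = trans (+-assoc x y (- y)) (trans (cong (x +_) (-‿inverseʳ y)) (+-identityʳ x))

  +-monoʳ-≤ : ∀ z {x y} → x ≤ y → z + x ≤ z + y
  +-monoʳ-≤ z {x} {y} x≤y rewrite +-comm z x | +-comm z y = +-monoˡ-≤ z x≤y

  +-mono₂-≤ : ∀ {x y u v} → x ≤ y → u ≤ v → x + u ≤ y + v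
  +-mono₂-≤ {y = y} {u} x≤y u≤v = ≤-trans (+-monoˡ-≤ u x≤y) (+-monoʳ-≤ y u≤v)

  +-cancelʳ-≤ : ∀ z {x y} → x + z ≤ y + z → x ≤ y
  +-cancelʳ-≤ z {x} {y} h = begin
    x           ≡⟨ x+y-y≡x x z ⟨
    x + z + - z ≤⟨ +-monoˡ-≤ (- z) h ⟩
    y + z + - z ≡⟨ x+y-y≡x y z ⟩
    y           ∎

  +-nonneg : ∀ {x y} → 0# ≤ x → 0# ≤ y → 0# ≤ x + y
  +-nonneg {x} {y} 0≤x 0≤y = begin
    0#      ≡⟨ +-identityʳ 0# ⟨
    0# + 0# ≤⟨ +-mono₂-≤ 0≤x 0≤y ⟩
    x + y   ∎

  x≤y⇒0≤y-x : ∀ {x y} → x ≤ y → 0# ≤ y + - x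
  x≤y⇒0≤y-x {x} {y} x≤y = +-cancelʳ-≤ x (begin
    0# + x      ≡⟨ +-identityˡ x ⟩
    x           ≤⟨ x≤y ⟩
    y           ≡⟨ x-y+y≡x y x ⟨
    y + - x + x ∎)

  *-monoˡ-≤ : ∀ {z x y} → 0# ≤ z → x ≤ y → z * x ≤ z * y
  *-monoˡ-≤ {z} {x} {y} 0≤z x≤y = begin
    z * x                  ≡⟨ +-identityˡ (z * x) ⟨
    0# + z * x             ≤⟨ +-monoˡ-≤ (z * x) (*-nonneg 0≤z (x≤y⇒0≤y-x x≤y)) ⟩
    z * (y + - x) + z * x  ≡⟨ distribˡ z (y + - x) x ⟨
    z * (y + - x + x)      ≡⟨ cong (z *_) (x-y+y≡x y x) ⟩
    z * y                  ∎

  *-monoʳ-≤ : ∀ {z x y} → 0# ≤ z → x ≤ y → x * z ≤ y * z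
  *-monoʳ-≤ {z} {x} {y} 0≤z x≤y rewrite *-comm x z | *-comm y z = *-monoˡ-≤ 0≤z x≤y

  posPart-nonneg : ∀ x → 0# ≤ posPart 𝕂 x
  posPart-nonneg x with total 0# x
  ... | inj₁ 0≤x = 0≤x
  ... | inj₂ _   = ≤-refl

  negPart-nonneg : ∀ x → 0# ≤ negPart 𝕂 x
  negPart-nonneg x with total 0# x
  ... | inj₁ _   = ≤-refl
  ... | inj₂ x≤0 = subst (0# ≤_) (+-identityˡ (- x)) (x≤y⇒0≤y-x x≤0)

  x+negPart≡posPart : ∀ x → x + negPart 𝕂 x ≡ posPart 𝕂 x
  x+negPart≡posPart x with total 0# x
  ... | inj₁ _ = +-identityʳ x
  ... | inj₂ _ = -‿inverseʳ x

  infix 8 _when_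
  _when_ : K → Bool → K
  x when b = if b then x else 0#

  when-+ : ∀ b x y → (x + y) when b ≡ x when b + y when b
  when-+ true  x y = refl
  when-+ false x y = sym (+-identityˡ 0#)

  when-nonneg : ∀ b {x} → 0# ≤ x → 0# ≤ x when b
  when-nonneg true  0≤x = 0≤x
  when-nonneg false _   = ≤-refl

  *-when : ∀ b x y → x * y when b ≡ x when b * y
  *-when true  x y = refl
  *-when false x y = trans (zeroʳ x) (sym (zeroˡ y))

  when≡* : ∀ b x → x when b ≡ 1# when b * x
  when≡* b x = trans (sym (*-identityˡ (x when b))) (*-when b 1# x)

  ∑ : ∀ {k} → (Fin k → K) → K
  ∑ = sumF 𝕂

  ∑≡sum : ∀ {k} (g : Fin k → K) → ∑ g ≡ sum g
  ∑≡sum {ℕ.zero}  g = refl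
  ∑≡sum {ℕ.suc k} g = cong (g zero +_) (∑≡sum (g ∘ suc))

  ∑-cong : ∀ {k} {g h : Fin k → K} → (∀ i → g i ≡ h i) → ∑ g ≡ ∑ h
  ∑-cong {ℕ.zero}  _  = refl
  ∑-cong {ℕ.suc k} eq = cong₂ _+_ (eq zero) (∑-cong (eq ∘ suc))

  ∑-mono : ∀ {k} {g h : Fin k → K} → (∀ i → g i ≤ h i) → ∑ g ≤ ∑ h
  ∑-mono {ℕ.zero}  _  = ≤-refl
  ∑-mono {ℕ.suc k} le = +-mono₂-≤ (le zero) (∑-mono (le ∘ suc))

  ∑-+ : ∀ {k} (g h : Fin k → K) → ∑ (λ i → g i + h i) ≡ ∑ g + ∑ h
  ∑-+ g h = trans (∑≡sum (λ i → g i + h i))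
    (trans (∑-distrib-+ g h) (sym (cong₂ _+_ (∑≡sum g) (∑≡sum h))))

  *-∑ : ∀ {k} x (g : Fin k → K) → x * ∑ g ≡ ∑ (λ i → x * g i)
  *-∑ x g = trans (cong (x *_) (∑≡sum g))
    (trans (*-distribˡ-sum x g) (sym (∑≡sum (λ i → x * g i))))

  ∑-swap : ∀ {k l} (h : Fin k → Fin l → K) → ∑ (λ i → ∑ (h i)) ≡ ∑ (λ j → ∑ (λ i → h i j))
  ∑-swap h = trans (trans (∑-cong (λ i → ∑≡sum (h i))) (∑≡sum (λ i → sum (h i))))
    (trans (∑-comm h)
      (sym (trans (∑-cong (λ j → ∑≡sum (λ i → h i j))) (∑≡sum (λ j → sum (λ i → h i j))))))

  ∑-zero : ∀ {k} (g : Fin k → K) → (∀ i → g i ≡ 0#) → ∑ g ≡ 0#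
  ∑-zero {ℕ.zero}  g eq = refl
  ∑-zero {ℕ.suc k} g eq = trans (cong₂ _+_ (eq zero) (∑-zero (g ∘ suc) (eq ∘ suc))) (+-identityˡ 0#)

  ∑-nonneg : ∀ {k} {g : Fin k → K} → Nonneg 𝕂 g → 0# ≤ ∑ g
  ∑-nonneg {ℕ.zero}  _   = ≤-refl
  ∑-nonneg {ℕ.suc k} 0≤g = +-nonneg (0≤g zero) (∑-nonneg (0≤g ∘ suc))

  single : ∀ {k} → Fin k → K → Fin k → K
  single p d a = d when does (a ≟ p)

  +-single-≢ : ∀ {k} {p a : Fin k} z d → a ≢ p → z + single p d a ≡ z
  +-single-≢ {p = p} {a} z d a≢p with a ≟ p
  ... | yes a≡p = contradiction a≡p a≢p
  ... | no _    = +-identityʳ z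

  -- Unfolds both to `inner` and to the objective of `IsMaxLP`, so primal and dual values share one
  -- calculus.
  dot : ∀ {k} → (Fin k → K) → (Fin k → K) → K
  dot f x = ∑ (λ a → f a * x a)

  dot-comm : ∀ {k} (f x : Fin k → K) → dot f x ≡ dot x f
  dot-comm f x = ∑-cong (λ a → *-comm (f a) (x a))

  dot-congʳ : ∀ {k} (f : Fin k → K) {x y : Fin k → K} → (∀ a → x a ≡ y a) → dot f x ≡ dot f y
  dot-congʳ f eq = ∑-cong (λ a → cong (f a *_) (eq a))

  dot-+ʳ : ∀ {k} (f x y : Fin k → K) → dot f (λ a → x a + y a) ≡ dot f x + dot f y
  dot-+ʳ f x y = trans (∑-cong (λ a → distribˡ (f a) (x a) (y a)))
    (∑-+ (λ a → f a * x a) (λ a → f a * y a))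

  dot-+ˡ : ∀ {k} (f g x : Fin k → K) → dot (λ a → f a + g a) x ≡ dot f x + dot g x
  dot-+ˡ f g x = trans (∑-cong (λ a → distribʳ (x a) (f a) (g a)))
    (∑-+ (λ a → f a * x a) (λ a → g a * x a))

  dot-*ˡ : ∀ {k} t (f x : Fin k → K) → dot (λ a → t * f a) x ≡ t * dot f x
  dot-*ˡ t f x = trans (∑-cong (λ a → *-assoc t (f a) (x a))) (sym (*-∑ t (λ a → f a * x a)))

  dot-zeroʳ : ∀ {k} (f : Fin k → K) → dot f (λ _ → 0#) ≡ 0#
  dot-zeroʳ f = ∑-zero _ (λ a → zeroʳ (f a))

  dot-zeroˡ : ∀ {k} (f : Fin k → K) → dot (λ _ → 0#) f ≡ 0#
  dot-zeroˡ f = ∑-zero _ (λ a → zeroˡ (f a))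

  dot-single : ∀ {k} (f : Fin k → K) p d → dot f (single p d) ≡ f p * d
  dot-single f zero    d = trans (cong (f zero * d +_) (dot-zeroʳ (f ∘ suc))) (+-identityʳ (f zero * d))
  dot-single f (suc p) d = trans (cong₂ _+_ (zeroʳ (f zero)) (dot-single (f ∘ suc) p d))
    (+-identityˡ (f (suc p) * d))

  -- Covers three sums at once: over `set g` it unfolds to `measure`, over the sets below `g` to
  -- `simpleSum`, and over the sets containing a point to the load in `DualFeasible`.
  ∑on : ∀ {k} → Sub k → (Fin k → K) → K
  ∑on A x = ∑ (λ a → x a when A a)

  ∑on≡dot : ∀ {k} (A : Sub k) x → ∑on A x ≡ dot (λ a → 1# when A a) x
  ∑on≡dot A x = ∑-cong (λ a → when≡* (A a) (x a))

  ∑on-cong : ∀ {k} (A : Sub k) {x y : Fin k → K} → (∀ a → x a ≡ y a) → ∑on A x ≡ ∑on A y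
  ∑on-cong A eq = ∑-cong (λ a → cong (_when A a) (eq a))

  ∑on-+ : ∀ {k} (A : Sub k) x y → ∑on A (λ a → x a + y a) ≡ ∑on A x + ∑on A y
  ∑on-+ A x y = trans (∑-cong (λ a → when-+ (A a) (x a) (y a)))
    (∑-+ (λ a → x a when A a) (λ a → y a when A a))

  ∑on-zero : ∀ {k} (A : Sub k) → ∑on A (λ _ → 0#) ≡ 0#
  ∑on-zero A = trans (∑on≡dot A (λ _ → 0#)) (dot-zeroʳ (λ a → 1# when A a))

  ∑on-nonneg : ∀ {k} (A : Sub k) {x : Fin k → K} → Nonneg 𝕂 x → 0# ≤ ∑on A x
  ∑on-nonneg A 0≤x = ∑-nonneg (λ a → when-nonneg (A a) (0≤x a))

  ∑on-+-single : ∀ {k} (A : Sub k) x p d →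
    ∑on A (λ a → x a + single p d a) ≡ ∑on A x + d when A p
  ∑on-+-single A x p d = trans (∑on-+ A x (single p d)) (cong (∑on A x +_)
    (trans (∑on≡dot A (single p d)) (trans (dot-single (λ a → 1# when A a) p d) (sym (when≡* (A p) d)))))

-- The greedy run with its primal and dual vectors.

module Monge (𝕂 : OrderedField) {n m : ℕ} (S : OrderedSystem n m) where
  open Arithmetic 𝕂
  open OrderedSystem S

  First : Sub n → Fin m → Set
  First X i = set i ⊆ X × (∀ j → set j ⊆ X → toℕ i ℕ.≤ toℕ j)

  -- `indexing` turns `i ≼ j` into an index inequality opposite to the one from minimality of `i`.
  -- Later, every join above `i` that stays inside `X` is identified with `i` in this way.
  first-top : ∀ {X i j} → First X i → i ≼ j → set j ⊆ X → j ≡ i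
  first-top {i = i} {j} (_ , first) i≼j j⊆X = toℕ-injective (ℕ.≤-antisym (indexing j i i≼j) (first j j⊆X))

  reduce : (Fin n → K) → Fin m → Fin n → Fin n → K
  reduce c i p a = c a + - (c p when set i a)

  -- The choices are kept as data together with their justifications, so that `primal` and `dual`
  -- are computed from one trace and every induction has the greedy conditions at hand.
  data Run : Sub n → (Fin n → K) → Set where
    done : ∀ {X c} → (∀ i → ¬ set i ⊆ X) → Run X c
    step : ∀ {X c} i p → First X i → set i p ≡ true → (∀ a → set i a ≡ true → c p ≤ c a) →
           Run (X ∖ p) (reduce c i p) → Run X c

  run : ∀ X c → Run X c
  run X c = go m X c (λ i _ → ℕ.m≤n+m m (toℕ i))
    where
    _⊆?_ : ∀ A B → Dec (A ⊆ B)
    A ⊆? B = all? (λ a → (A a Bool.≟ true) →-dec (B a Bool.≟ true))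

    -- `k` is fuel: the sets still inside `X` have index at least `m - k`. This is trivial for
    -- `k = m`, and for `k = 0` no index is left. A step may spend one unit because `set i` contains
    -- the deleted `p`, so the sets that remain have strictly larger index.
    go : ∀ k X c → (∀ i → set i ⊆ X → m ℕ.≤ toℕ i ℕ.+ k) → Run X c
    go k X c bound with any? (λ i → set i ⊆? X)
    go k X c bound | no none = done (λ i i⊆X → none (i , i⊆X))
    go k X c bound | yes some with minimal-element ℕ.≤-totalOrder (λ i → set i ⊆? X) toℕ some
    go ℕ.zero X c bound | yes _ | i , i⊆X , _ =
      contradiction (subst (m ℕ.≤_) (ℕ.+-identityʳ (toℕ i)) (bound i i⊆X)) (ℕ.<⇒≱ (toℕ<n i))
    go (ℕ.suc k) X c bound | yes _ | i , i⊆X , first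
      with minimal-element totalOrder (λ a → set i a Bool.≟ true) c (nonempty i)
    ... | p , p∈i , least = step i p (i⊆X , first) p∈i least (go k (X ∖ p) (reduce c i p) bound′)
      where
      bound′ : ∀ j → set j ⊆ (X ∖ p) → m ℕ.≤ toℕ j ℕ.+ k
      bound′ j j⊆ = ℕ.≤-trans (bound i i⊆X)
        (subst (ℕ._≤ toℕ j ℕ.+ k) (sym (ℕ.+-suc (toℕ i) k)) (ℕ.+-monoˡ-≤ k i<j))
        where
        i<j : toℕ i ℕ.< toℕ j
        i<j = ℕ.≤∧≢⇒< (first j (⊆-trans j⊆ (∖-⊆ X p)))
          (λ eq → true≢false (subst (λ l → set l p ≡ true) (toℕ-injective eq) p∈i) (∉-of-⊆∖ X p j⊆))

  -- Backward substitution: the value at `p` is whatever the later values leave missing in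
  -- `x(set i) = w i`. Sets chosen later avoid `p`, so their equations are not disturbed.
  primal : ∀ {X c} → (Fin m → K) → Run X c → Fin n → K
  primal w (done _)             _ = 0#
  primal w (step i p _ _ _ r) a =
    primal w r a + single p (w i + - measure 𝕂 S (primal w r) i) a

  dual : ∀ {X c} → Run X c → Fin m → K
  dual (done _)                   _ = 0#
  dual (step {c = c} i p _ _ _ r) g = dual r g + single i (c p) g

  reduce-nonneg : ∀ {c} i p → Nonneg 𝕂 c → (∀ a → set i a ≡ true → c p ≤ c a) →
    Nonneg 𝕂 (reduce c i p)
  reduce-nonneg {c} i p 0≤c least a with set i a in eq
  ... | true  = x≤y⇒0≤y-x (least a eq)
  ... | false = x≤y⇒0≤y-x (0≤c a)

  -- By induction the later charges fit under the reduced weights; the new charge `c p` falls on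
  -- exactly the points of `set i` and uses up what `reduce` subtracted there. Leastness of `c p`
  -- keeps the reduced weights nonnegative.
  dual-feasible : ∀ {X c} (r : Run X c) → Nonneg 𝕂 c → DualFeasible 𝕂 S c (dual r)
  dual-feasible (done _) 0≤c =
    (λ _ → ≤-refl) , λ a → subst (_≤ _) (sym (∑on-zero (λ g → set g a))) (0≤c a)
  dual-feasible (step {c = c} i p _ _ least r) 0≤c
    with dual-feasible r (reduce-nonneg i p 0≤c least)
  ... | 0≤y , load = (λ g → +-nonneg (0≤y g) (when-nonneg (does (g ≟ i)) (0≤c p))) , λ a → begin
    ∑on (λ g → set g a) (λ g → dual r g + single i (c p) g)
      ≡⟨ ∑on-+-single (λ g → set g a) (dual r) i (c p) ⟩
    ∑on (λ g → set g a) (dual r) + c p when set i a  ≤⟨ +-monoˡ-≤ _ (load a) ⟩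
    c a + - (c p when set i a) + c p when set i a    ≡⟨ x-y+y≡x (c a) _ ⟩
    c a                                              ∎

  dot-reduce : ∀ c i p x → dot (reduce c i p) x + c p * measure 𝕂 S x i ≡ dot c x
  dot-reduce c i p x = trans (cong (dot (reduce c i p) x +_) (*-∑ (c p) (λ a → x a when set i a)))
    (trans (sym (∑-+ (λ a → reduce c i p a * x a) (λ a → c p * x a when set i a)))
      (∑-cong (λ a → termwise (set i a) (c a) (x a))))
    where
    termwise : ∀ b u z → (u + - (c p when b)) * z + c p * z when b ≡ u * z
    termwise b u z = trans (cong ((u + - (c p when b)) * z +_) (*-when b (c p) z))
      (trans (sym (distribʳ z (u + - (c p when b)) (c p when b))) (cong (_* z) (x-y+y≡x u (c p when b))))

  -- Each step adds `c p * w i` to either side. On the primal side it is `c p` times the measure of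
  -- `set i`, split off by `dot-reduce`, plus `c p` times the amount put on `p`.
  strong-duality : ∀ {X c} (r : Run X c) w → dot c (primal w r) ≡ dot (dual r) w
  strong-duality {c = c} (done _) w = trans (dot-zeroʳ c) (sym (dot-zeroˡ w))
  strong-duality {c = c} (step i p _ _ _ r) w = begin-equality
    dot c (λ a → x a + single p d a)
      ≡⟨ trans (dot-+ʳ c x (single p d)) (cong (dot c x +_) (dot-single c p d)) ⟩
    dot c x + c p * d
      ≡⟨ cong (_+ c p * d) (sym (dot-reduce c i p x)) ⟩
    dot (reduce c i p) x + c p * measure 𝕂 S x i + c p * d
      ≡⟨ solve 4 (λ u t y z → u :+ t :* y :+ t :* z := u :+ t :* (z :+ y)) refl
            (dot (reduce c i p) x) (c p) (measure 𝕂 S x i) d ⟩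
    dot (reduce c i p) x + c p * (d + measure 𝕂 S x i)
      ≡⟨ cong₂ _+_ (strong-duality r w)
            (trans (cong (c p *_) (x-y+y≡x (w i) (measure 𝕂 S x i))) (*-comm (c p) (w i))) ⟩
    dot (dual r) w + w i * c p
      ≡⟨ cong (dot (dual r) w +_) (trans (sym (dot-single w i (c p))) (dot-comm w (single i (c p)))) ⟩
    dot (dual r) w + dot (single i (c p)) w
      ≡⟨ sym (dot-+ˡ (dual r) (single i (c p)) w) ⟩
    dot (λ g → dual r g + single i (c p) g) w ∎
    where
    x = primal w r
    d = w i + - measure 𝕂 S x i

  weak-duality : ∀ {w f x y} → PrimalFeasible 𝕂 S w x → DualFeasible 𝕂 S f y → dot y w ≤ dot f x
  weak-duality {w} {f} {x} {y} (0≤x , w≤x) (0≤y , load≤f) = begin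
    dot y w                                    ≤⟨ ∑-mono (λ g → *-monoˡ-≤ (0≤y g) (w≤x g)) ⟩
    dot y (measure 𝕂 S x)                      ≡⟨ ∑-cong (λ g → *-∑ (y g) (λ a → x a when set g a)) ⟩
    ∑ (λ g → ∑ (λ a → y g * x a when set g a)) ≡⟨ ∑-swap (λ g a → y g * x a when set g a) ⟩
    ∑ (λ a → ∑ (λ g → y g * x a when set g a)) ≡⟨ ∑-cong collect ⟩
    dot (λ a → ∑on (λ g → set g a) y) x        ≤⟨ ∑-mono (λ a → *-monoʳ-≤ (0≤x a) (load≤f a)) ⟩
    dot f x                                    ∎
    where
    collect : ∀ a → ∑ (λ g → y g * x a when set g a) ≡ ∑on (λ g → set g a) y * x a
    collect a = trans
      (∑-cong (λ g → trans (*-when (set g a) (y g) (x a)) (*-comm (y g when set g a) (x a))))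
      (trans (sym (*-∑ (x a) (λ g → y g when set g a))) (*-comm (x a) (∑on (λ g → set g a) y)))

  -- Only a chosen `p` receives a value, and it lies in the set chosen with it. The set `l` gives
  -- the order axioms something to act on at a point with nonzero value.
  primal-support : ∀ {X c} w (r : Run X c) a →
    primal w r a ≡ 0# ⊎ ∃ λ l → set l ⊆ X × set l a ≡ true
  primal-support w (done _) a = inj₁ refl
  primal-support {X} w (step i p (i⊆X , _) p∈i _ r) a with a ≟ p
  ... | yes refl = inj₂ (i , i⊆X , p∈i)
  ... | no _ with primal-support w r a
  ...   | inj₁ xa≡0           = inj₁ (trans (cong (_+ 0#) xa≡0) (+-identityˡ 0#))
  ...   | inj₂ (l , l⊆ , a∈l) = inj₂ (l , ⊆-trans l⊆ (∖-⊆ X p) , a∈l)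

  -- Feasibility of the primal vector for a supermodular capacity.

  module _ (consecutive : Consecutive S) (is0 : IS0 S) (is1 : IS1 S)
           {w : Fin m → K} (capacity : Capacity 𝕂 S w) (supermodular : Supermodular 𝕂 S w) where

    -- (IS0) gives an upper bound of `j` and `i` inside their union, hence inside `X`, and
    -- `first-top` collapses it to `i`.
    first-above : ∀ {X i j} → First X i → set j ⊆ X → Meets (set j) (set i) → j ≼ i
    first-above {i = i} {j} first j⊆X meets with is0 j i meets
    ... | k , k⊆ , j≼k , i≼k = subst (j ≼_) (first-top first i≼k (⊆∪ k⊆ j⊆X (proj₁ first))) j≼k

    -- The same collapse, with the upper bound of `i` and `k` coming from (IS1): the common lower
    -- bound `j` takes the place of a common point.
    first-absorbs : ∀ {X i j k} → First X i → set k ⊆ X → j ≼ i → j ≼ k → k ≼ i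
    first-absorbs {i = i} {j} {k} first k⊆X j≼i j≼k with is1 j i k j≼i j≼k
    ... | t , _ , t⊆ , _ , _ , _ , _ , i≼t , k≼t =
      subst (k ≼_) (first-top first i≼t (⊆∪ t⊆ (proj₁ first) k⊆X)) k≼t

    -- Nothing above a member of the family is `nothing`, so the upper set delivered by
    -- supermodularity is itself a member.
    join : ∀ i j → CoIntersecting S i j → ∃ λ t → set t ⊆ (set i ∪ set j) × i ≼ t × j ≼ t
    join i j co with supermodular i j co
    ... | _ , just t , _ , t⊆ , _ , _ , i≼t , j≼t , _ = t , t⊆ , i≼t , j≼t

    between : ∀ {i j k a} → i ≼ j → j ≼ k → set i a ≡ true → set k a ≡ true → set j a ≡ true
    between {i} {j} {k} {a} i≼j j≼k a∈i a∈k =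
      consecutive i j k i≼j j≼k a (subst (λ b → (if b then set k a else false) ≡ true) (sym a∈i) a∈k)

    measure-at-chosen : ∀ {x : Fin n → K} {i p} → set i p ≡ true →
      measure 𝕂 S (λ a → x a + single p (w i + - measure 𝕂 S x i) a) i ≡ w i
    measure-at-chosen {x} {i} {p} p∈i = trans (∑on-+-single (set i) x p _)
      (trans (cong (λ b → measure 𝕂 S x i + (w i + - measure 𝕂 S x i) when b) p∈i)
        (trans (+-comm (measure 𝕂 S x i) _) (x-y+y≡x (w i) (measure 𝕂 S x i))))

    measure-off-chosen : ∀ {x : Fin n → K} (A : Sub n) {p d} → A p ≡ false →
      ∑on A (λ a → x a + single p d a) ≡ ∑on A x
    measure-off-chosen {x} A {p} {d} p∉A = trans (∑on-+-single A x p d)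
      (trans (cong (λ b → ∑on A x + d when b) p∉A) (+-identityʳ (∑on A x)))

    -- The chosen sets meeting an earlier chosen set F_i form a chain, so the next of them
    -- contains all points of F_i chosen later.
    NextTight : ∀ {X c} → Run X c → Fin m → Set
    NextTight {X} r i = ∃ λ j → set j ⊆ X × Meets (set i) (set j) ×
      measure 𝕂 S (primal w r) j ≡ w j ×
      (∀ a → set i a ≡ true → primal w r a ≡ 0# ⊎ set j a ≡ true)

    -- Scans the run for the first step whose deleted point lies in `set i`. `Y` is the set in which
    -- `i` was first and stays fixed while `X` shrinks.
    next-tight : ∀ {X Y c} (r : Run X c) i → First Y i → X ⊆ Y →
      (∀ a → set i a ≡ true → primal w r a ≡ 0#) ⊎ NextTight r i
    next-tight (done _) i _ _ = inj₁ (λ _ _ → refl)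
    next-tight {X} r@(step j p firstj p∈j _ r′) i firsti X⊆Y with set i p in p∈?i
    ... | true = inj₂ (j , proj₁ firstj , (p , p∈?i , p∈j) , measure-at-chosen p∈j , tight)
      where
      tight : ∀ a → set i a ≡ true → primal w r a ≡ 0# ⊎ set j a ≡ true
      tight a a∈i with primal-support w r a
      ... | inj₁ xa≡0 = inj₁ xa≡0
      -- `a` lies in both ends of `l ≼ j ≼ i`, so consecutivity places it in `set j`.
      ... | inj₂ (l , l⊆X , a∈l) = inj₂ (between l≼j j≼i a∈l a∈i)
        where
        j⊆Y = ⊆-trans (proj₁ firstj) X⊆Y
        j≼i : j ≼ i
        j≼i = first-above firsti j⊆Y (p , p∈j , p∈?i)
        l≼j : l ≼ j
        -- `set i` meets `j` in `p` and `l` in `a`, and its index is least within `Y`, so it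
        -- witnesses that `j` and `l` co-intersect.
        l≼j with join j l (i , proj₂ firsti j j⊆Y , proj₂ firsti l (⊆-trans l⊆X X⊆Y) ,
                           (p , p∈?i , p∈j) , (a , a∈i , a∈l))
        ... | t , t⊆ , j≼t , l≼t = subst (l ≼_) (first-top firstj j≼t (⊆∪ t⊆ (proj₁ firstj) l⊆X)) l≼t
    -- Here `p` is outside `set i`: the step leaves x unchanged on `set i`, and a set inside `X ∖ p`
    -- keeps its measure, so the later answer carries over.
    ... | false with next-tight r′ i firsti (⊆-trans (∖-⊆ X p) X⊆Y)
    ...   | inj₁ vanishes = inj₁ (λ a a∈i → trans (unchanged a a∈i) (vanishes a a∈i))
      where
      unchanged : ∀ a → set i a ≡ true → primal w r a ≡ primal w r′ a
      unchanged a a∈i = +-single-≢ {p = p} {a} _ _ (λ { refl → true≢false a∈i p∈?i })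
    ...   | inj₂ (k , k⊆ , meets , tight , cover) =
      inj₂ (k , ⊆-trans k⊆ (∖-⊆ X p) , meets ,
            trans (measure-off-chosen (set k) (∉-of-⊆∖ X p k⊆)) tight , cover′)
      where
      cover′ : ∀ a → set i a ≡ true → primal w r a ≡ 0# ⊎ set k a ≡ true
      cover′ a a∈i with cover a a∈i
      ... | inj₂ a∈k  = inj₂ a∈k
      ... | inj₁ xa≡0 = inj₁ (trans (+-single-≢ {p = p} {a} _ _ (λ { refl → true≢false a∈i p∈?i })) xa≡0)

    Feasible : Sub n → (Fin n → K) → Set
    Feasible X x = Nonneg 𝕂 x × (∀ g → set g ⊆ X → w g ≤ measure 𝕂 S x g)

    measure-mono-on-support : ∀ {x : Fin n → K} → Nonneg 𝕂 x → (A B : Sub n) →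
      (∀ a → A a ≡ true → x a ≡ 0# ⊎ B a ≡ true) → ∑on A x ≤ ∑on B x
    measure-mono-on-support {x} 0≤x A B sub = ∑-mono pointwise
      where
      pointwise : ∀ a → x a when A a ≤ x a when B a
      pointwise a with A a in eqA
      ... | false = when-nonneg (B a) (0≤x a)
      ... | true with sub a eqA
      ...   | inj₁ xa≡0 = ≤-trans (≤-reflexive xa≡0) (when-nonneg (B a) (0≤x a))
      ...   | inj₂ a∈B  rewrite a∈B = ≤-refl

    -- Away from the zeros of `x`, the hypotheses say that `A ∩ I` lies in `G ∩ J` and `A ∪ I` in
    -- `G ∪ J`; the inequality then holds point by point.
    measure-uncross : ∀ {x : Fin n → K} → Nonneg 𝕂 x → (A I G J : Sub n) → A ⊆ (G ∪ J) →
      (∀ a → A a ≡ true → I a ≡ true → G a ≡ true) →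
      (∀ a → I a ≡ true → x a ≡ 0# ⊎ J a ≡ true) →
      ∑on A x + ∑on I x ≤ ∑on G x + ∑on J x
    measure-uncross {x} 0≤x A I G J A⊆G∪J A∩I⊆G I⊆J = begin
      ∑on A x + ∑on I x                      ≡⟨ ∑-+ (λ a → x a when A a) (λ a → x a when I a) ⟨
      ∑ (λ a → x a when A a + x a when I a)  ≤⟨ ∑-mono (λ a → pointwise a (I⊆J a)) ⟩
      ∑ (λ a → x a when G a + x a when J a)  ≡⟨ ∑-+ (λ a → x a when G a) (λ a → x a when J a) ⟩
      ∑on G x + ∑on J x                      ∎
      where
      when-0 : ∀ a → x a ≡ 0# → ∀ b → x a when b ≡ 0#
      when-0 a xa≡0 true  = xa≡0
      when-0 a xa≡0 false = refl

      pointwise : ∀ a → (I a ≡ true → x a ≡ 0# ⊎ J a ≡ true) →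
        x a when A a + x a when I a ≤ x a when G a + x a when J a
      pointwise a I⊆J with I a in eqI
      pointwise a I⊆J | true with I⊆J refl
      ... | inj₁ xa≡0 = ≤-reflexive (cong₂ _+_ (trans (when-0 a xa≡0 (A a)) (sym (when-0 a xa≡0 (G a))))
                                                (trans xa≡0 (sym (when-0 a xa≡0 (J a)))))
      ... | inj₂ a∈J with A a in eqA
      ...   | true  rewrite a∈J | A∩I⊆G a eqA eqI = ≤-refl
      ...   | false rewrite a∈J = +-monoˡ-≤ (x a) (when-nonneg (G a) (0≤x a))
      pointwise a I⊆J | false with A a in eqA
      ... | false = +-mono₂-≤ (when-nonneg (G a) (0≤x a)) (when-nonneg (J a) (0≤x a))
      ... | true with G a in eqG | A⊆G∪J a eqA
      ...   | true  | _   = +-monoʳ-≤ (x a) (when-nonneg (J a) (0≤x a))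
      ...   | false | a∈J rewrite a∈J = ≤-reflexive (+-comm (x a) 0#)

    -- The induction step for feasibility: the later values `x` are feasible inside `X ∖ p`, and the
    -- point `p` is about to receive `slack`.
    module Step {X c i p} (first : First X i) (p∈i : set i p ≡ true) (r : Run (X ∖ p) c)
                (feasible : Feasible (X ∖ p) (primal w r)) where
      x = primal w r
      0≤x = proj₁ feasible

      μ : Fin m → K
      μ = measure 𝕂 S x

      slack = w i + - μ i

      i⊆X = proj₁ first

      next = next-tight r i first (∖-⊆ X p)

      μ-vanishes : (∀ a → set i a ≡ true → x a ≡ 0#) → μ i ≡ 0#
      μ-vanishes x≡0 = ∑-zero _ pointwise
        where
        pointwise : ∀ a → x a when set i a ≡ 0#
        pointwise a with set i a in eq
        ... | true  = x≡0 a eq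
        ... | false = refl

      -- If `x` vanishes on `set i`, this is nonnegativity of `w`. Otherwise the mass of `set i`
      -- sits inside the next tight set `j`, and `j ≼ i` with monotonicity gives `w j ≤ w i`.
      slack-nonneg : 0# ≤ slack
      slack-nonneg = x≤y⇒0≤y-x (bound next)
        where
        bound : _ → μ i ≤ w i
        bound (inj₁ x≡0) = ≤-trans (≤-reflexive (μ-vanishes x≡0)) (proj₁ capacity i)
        bound (inj₂ (j , j⊆ , (a , a∈i , a∈j) , tight , cover)) = begin
          μ i ≤⟨ measure-mono-on-support 0≤x (set i) (set j) cover ⟩
          μ j ≡⟨ tight ⟩
          w j ≤⟨ proj₂ capacity j i (first-above first (⊆-trans j⊆ (∖-⊆ X p)) (a , a∈j , a∈i)) ⟩
          w i ∎

      -- The core use of supermodularity, applied to `g` and the next tight set `j`. The lower set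
      -- avoids `p`, so the induction hypothesis bounds its value; the upper set lies below `i` by
      -- `first-absorbs`, so its value is at most `w i`. Uncrossing measures then leaves exactly the
      -- slack. If `x` vanishes on `set i`, the slack is `w i` and monotonicity is enough.
      through-p : ∀ g → set g ⊆ X → set g p ≡ true → w g ≤ μ g + slack
      through-p g g⊆X p∈g = bound next
        where
        g≼i : g ≼ i
        g≼i = first-above first g⊆X (p , p∈g , p∈i)

        bound : _ → w g ≤ μ g + slack
        bound (inj₁ x≡0) = begin
          w g             ≤⟨ proj₂ capacity g i g≼i ⟩
          w i             ≡⟨ x-y+y≡x (w i) (μ i) ⟨
          slack + μ i     ≡⟨ cong (slack +_) (μ-vanishes x≡0) ⟩
          slack + 0#      ≤⟨ +-monoʳ-≤ slack (∑on-nonneg (set g) 0≤x) ⟩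
          slack + μ g     ≡⟨ +-comm slack (μ g) ⟩
          μ g + slack     ∎
        bound (inj₂ (j , j⊆ , (a , a∈i , a∈j) , tight , cover))
          -- `set i` again witnesses co-intersection: it meets `g` in `p` and `j` in `a`, with index
          -- at most both.
          with supermodular g j (i , indexing i g g≼i , proj₂ first j j⊆X , (p , p∈i , p∈g) , (a , a∈i , a∈j))
          where j⊆X = ⊆-trans j⊆ (∖-⊆ X p)
        ... | A , just t , A⊆ , t⊆ , A≼g , A≼j , g≼t , _ , uncross =
          -- `w j` is added to apply supermodularity and returns as `μ j` by tightness; `μ i` is
          -- added for the uncrossing and returns from `w i = slack + μ i`.
          +-cancelʳ-≤ (w j + μ i) (begin
            w g + (w j + μ i)           ≡⟨ +-assoc (w g) (w j) (μ i) ⟨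
            w g + w j + μ i             ≤⟨ +-monoˡ-≤ (μ i) uncross ⟩
            val₀ 𝕂 S w A + w t + μ i              ≤⟨ +-monoˡ-≤ (μ i) (+-mono₂-≤ (meet-bound A A⊆ A≼g A≼j)
                                             (proj₂ capacity t i (first-absorbs first t⊆X g≼i g≼t))) ⟩
            μA + w i + μ i              ≡⟨ solve 3 (λ u s z → u :+ s :+ z := u :+ z :+ s) refl μA (w i) (μ i) ⟩
            μA + μ i + w i              ≤⟨ +-monoˡ-≤ (w i) (measure-uncross 0≤x (set₀ A) (set i) (set g) (set j)
                                             A⊆ (A∩i⊆g A A≼g) cover) ⟩
            μ g + μ j + w i             ≡⟨ cong₂ (λ u s → μ g + u + s) tight (sym (x-y+y≡x (w i) (μ i))) ⟩
            μ g + w j + (slack + μ i)   ≡⟨ solve 4 (λ u s z y → u :+ s :+ (z :+ y) := u :+ z :+ (s :+ y)) refl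
                                             (μ g) (w j) slack (μ i) ⟩
            μ g + slack + (w j + μ i)   ∎)
          where
          j⊆X = ⊆-trans j⊆ (∖-⊆ X p)
          j≼i : j ≼ i
          j≼i = first-above first j⊆X (a , a∈j , a∈i)
          t⊆X = ⊆∪ t⊆ g⊆X j⊆X
          μA = ∑on (set₀ A) x

          A∩i⊆g : ∀ A → A ≼₀ just g → ∀ a → set₀ A a ≡ true → set i a ≡ true → set g a ≡ true
          A∩i⊆g (just k) k≼g a a∈k a∈i = between k≼g g≼i a∈k a∈i

          meet-bound : ∀ A → set₀ A ⊆ (set g ∪ set j) → A ≼₀ just g → A ≼₀ just j →
            val₀ 𝕂 S w A ≤ ∑on (set₀ A) x
          meet-bound nothing  _  _ _   = ∑on-nonneg emptySub 0≤x
          meet-bound (just k) k⊆ _ k≼j = proj₂ feasible k (⊆-∖ (⊆∪ k⊆ g⊆X j⊆X) p∉k)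
            where
            p∉k : set k p ≡ false
            -- With `k ≼ j ≼ i`, a point `p` in `set k` would by consecutivity lie in `set j`, which
            -- is inside `X ∖ p`.
            p∉k = ¬-not (λ p∈k → true≢false (between k≼j j≼i p∈k p∈i) (∉-of-⊆∖ X p j⊆))

    -- A set through `p` gains exactly the slack; a set avoiding `p` lies in `X ∖ p` and keeps its
    -- measure.
    primal-feasible : ∀ {X c} (r : Run X c) → Feasible X (primal w r)
    primal-feasible (done none) = (λ _ → ≤-refl) , λ g g⊆X → contradiction g⊆X (none g)
    primal-feasible {X} (step i p first p∈i _ r) =
      (λ a → +-nonneg (0≤x a) (when-nonneg (does (a ≟ p)) slack-nonneg)) , dominates
      where
      feasible = primal-feasible r
      open Step first p∈i r feasible
      dominates : ∀ g → set g ⊆ X → w g ≤ measure 𝕂 S (λ a → x a + single p slack a) g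
      dominates g g⊆X with set g p in p∈?g
      ... | true  = ≤-trans (through-p g g⊆X p∈?g) (≤-reflexive (sym
        (trans (∑on-+-single (set g) x p slack) (cong (λ b → μ g + slack when b) p∈?g))))
      ... | false = ≤-trans (proj₂ feasible g (⊆-∖ g⊆X p∈?g))
        (≤-reflexive (sym (measure-off-chosen (set g) p∈?g)))

  -- Optimal values of the two linear programs.

  Attains : (Fin n → K) → (Fin m → K) → (Fin m → K) → Set
  Attains f y w = Σ (Fin n → K) λ x → PrimalFeasible 𝕂 S w x × dot f x ≡ dot y w

  -- With `y` fixed, primal solutions and their values add. This carries optimality of `y` from
  -- multiples of simple functions to their sums.
  attains-∑ : ∀ {f y k} (W : Fin k → Fin m → K) → (∀ i → Attains f y (W i)) →
    Attains f y (λ g → ∑ (λ i → W i g))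
  attains-∑ {f} {y} {ℕ.zero} W _ = (λ _ → 0#) ,
    ((λ _ → ≤-refl) , λ g → ≤-reflexive (sym (∑on-zero (set g)))) ,
    trans (dot-zeroʳ f) (sym (dot-zeroʳ y))
  attains-∑ {f} {y} {ℕ.suc k} W att with att zero | attains-∑ (W ∘ suc) (att ∘ suc)
  ... | x , (0≤x , W≤x) , fx | x′ , (0≤x′ , W≤x′) , fx′ =
    (λ a → x a + x′ a) ,
    ((λ a → +-nonneg (0≤x a) (0≤x′ a)) ,
     λ g → ≤-trans (+-mono₂-≤ (W≤x g) (W≤x′ g)) (≤-reflexive (sym (∑on-+ (set g) x x′)))) ,
    trans (dot-+ʳ f x x′) (trans (cong₂ _+_ fx fx′) (sym (dot-+ʳ y (W zero) (λ g → ∑ (λ i → W (suc i) g)))))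

  isMinLP : ∀ {f y w} → DualFeasible 𝕂 S f y → Attains f y w → IsMinLP 𝕂 S w f (dot y w)
  isMinLP feasible attains = attains , λ _ x-feasible → weak-duality x-feasible feasible

  isMaxLP : ∀ {f y w} → DualFeasible 𝕂 S f y → Attains f y w → IsMaxLP 𝕂 S w f (dot y w)
  isMaxLP feasible (x , x-feasible , fx) =
    (_ , feasible , refl) , λ _ y′-feasible → subst (_ ≤_) fx (weak-duality x-feasible y′-feasible)

  minLP-unique : ∀ {w f c d} → IsMinLP 𝕂 S w f c → IsMinLP 𝕂 S w f d → c ≡ d
  minLP-unique ((x , xf , refl) , c≤) ((x′ , xf′ , refl) , d≤) = ≤-antisym (c≤ x′ xf′) (d≤ x xf)

  minLP-scale : ∀ {t w f c} → 0# ≤ t → IsMinLP 𝕂 S w f c → IsMinLP 𝕂 S w (λ a → t * f a) (t * c)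
  minLP-scale {t} {f = f} 0≤t ((x , x-feasible , fx) , c≤) =
    (x , x-feasible , trans (dot-*ˡ t f x) (cong (t *_) fx)) ,
    λ x′ x′-feasible → ≤-trans (*-monoˡ-≤ 0≤t (c≤ x′ x′-feasible)) (≤-reflexive (sym (dot-*ˡ t f x′)))

  -- Expansion in simple functions.

  mobius : ∀ v → Σ (Fin m → K) (IsMobius 𝕂 S v)
  mobius v with go m
    where
    -- Only sets F ≼ G contribute at G and their index is at least that of G, so the
    -- coefficients can be fixed in order of decreasing index.
    go : ∀ k → Σ (Fin m → K) λ β → ∀ g → m ℕ.≤ toℕ g ℕ.+ k → v g ≡ simpleSum 𝕂 S β g
    go ℕ.zero = (λ _ → 0#) , λ g m≤g →
      contradiction (subst (m ℕ.≤_) (ℕ.+-identityʳ (toℕ g)) m≤g) (ℕ.<⇒≱ (toℕ<n g))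
    go (ℕ.suc k) with go k | any? (λ i → toℕ i ℕ.+ ℕ.suc k ℕ.≟ m)
    ... | β , fits | no none = β , λ g m≤ → fits g
      (ℕ.s≤s⁻¹ (subst (m ℕ.<_) (ℕ.+-suc (toℕ g) k) (ℕ.≤∧≢⇒< m≤ (λ eq → none (g , sym eq)))))
    ... | β , fits | yes (i , i+1+k≡m) = (λ f → β f + single i d f) , fits′
      where
      -- The defect at `i`. Adding it to the coefficient repairs `i`, as `i ≼ i`, and preserves the
      -- equations at larger indices: `i ≼ g` would force the index of `g` to be at most that of
      -- `i`.
      d = v i + - simpleSum 𝕂 S β i
      fits′ : ∀ g → m ℕ.≤ toℕ g ℕ.+ ℕ.suc k → v g ≡ simpleSum 𝕂 S (λ f → β f + single i d f) g
      fits′ g m≤ with g ≟ i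
      ... | yes refl = sym (trans (∑on-+-single (λ f → le f i) β i d)
        (trans (cong (λ b → simpleSum 𝕂 S β i + d when b) (≼-refl i))
          (trans (+-comm (simpleSum 𝕂 S β i) d) (x-y+y≡x (v i) (simpleSum 𝕂 S β i)))))
      ... | no g≢i = trans (fits g m≤g+k) (sym (trans (∑on-+-single (λ f → le f g) β i d)
        (trans (cong (λ b → simpleSum 𝕂 S β g + d when b) (¬-not i⋠g)) (+-identityʳ _))))
        where
        i<g : toℕ i ℕ.< toℕ g
        i<g = ℕ.≤∧≢⇒< (ℕ.+-cancelʳ-≤ (ℕ.suc k) (toℕ i) (toℕ g) (subst (ℕ._≤ toℕ g ℕ.+ ℕ.suc k) (sym i+1+k≡m) m≤))
          (λ eq → g≢i (sym (toℕ-injective eq)))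
        i⋠g : ¬ i ≼ g
        i⋠g i≼g = ℕ.<⇒≱ i<g (indexing g i i≼g)
        m≤g+k : m ℕ.≤ toℕ g ℕ.+ k
        m≤g+k = subst (ℕ._≤ toℕ g ℕ.+ k) (trans (sym (ℕ.+-suc (toℕ i) k)) i+1+k≡m) (ℕ.+-monoˡ-≤ k i<g)
  ... | β , fits = β , λ g → fits g (ℕ.m≤n+m m (toℕ g))

  -- Nonnegative multiples of simple functions as supermodular capacities.

  module _ (is1 : IS1 S) {v : Fin m → K} (supermodular : Supermodular 𝕂 S v) where

    ζ-capacity : ∀ {b} → 0# ≤ b → ∀ f → Capacity 𝕂 S (λ g → b when le f g)
    ζ-capacity {b} 0≤b f = (λ g → when-nonneg (le f g) 0≤b) , monotone
      where
      monotone : ∀ g h → g ≼ h → b when le f g ≤ b when le f h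
      monotone g h g≼h with le f g in f≼?g
      ... | true  rewrite ≼-trans f g h f≼?g g≼h = ≤-refl
      ... | false = when-nonneg (le f h) 0≤b

    -- If `i` and `j` are both above `f`, (IS1) gives a lower set still above `f`, and both sides
    -- are `b + b`. Otherwise the lower set is empty, and the upper set supplied by supermodularity
    -- of `v` is above `f` as soon as `i` or `j` is.
    ζ-supermodular : ∀ {b} → 0# ≤ b → ∀ f → Supermodular 𝕂 S (λ g → b when le f g)
    ζ-supermodular {b} 0≤b f i j co with le f i in f≼?i
    ... | false with supermodular i j co
    ...   | _ , just t , _ , t⊆ , _ , _ , i≼t , j≼t , _ =
      nothing , just t , (λ _ ()) , t⊆ , tt , tt , i≼t , j≼t ,
      +-monoʳ-≤ 0# (proj₂ (ζ-capacity 0≤b f) j t j≼t)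
    ζ-supermodular {b} 0≤b f i j co | true with le f j in f≼?j
    ... | true with is1 f i j f≼?i f≼?j
    ...   | t , s , t⊆ , s⊆ , f≼s , s≼i , s≼j , i≼t , j≼t =
      just s , just t , s⊆ , t⊆ , s≼i , s≼j , i≼t , j≼t , bound
      where
      bound : b + b ≤ b when le f s + b when le f t
      bound rewrite f≼s | ≼-trans f i t f≼?i i≼t = ≤-refl
    ζ-supermodular {b} 0≤b f i j co | true | false with supermodular i j co
    ... | _ , just t , _ , t⊆ , _ , _ , i≼t , j≼t , _ =
      nothing , just t , (λ _ ()) , t⊆ , tt , tt , i≼t , j≼t , bound
      where
      bound : b + 0# ≤ 0# + b when le f t
      bound rewrite ≼-trans f i t f≼?i i≼t = ≤-reflexive (+-comm b 0#)

  -- Coefficientwise `β + negPart β = posPart β`, hence `v + v⁻ = v⁺`; the claim is linearity of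
  -- `dot y`.
  mobius-parts : ∀ {v β} → IsMobius 𝕂 S v β → ∀ y →
    dot y (simpleSum 𝕂 S (posPart 𝕂 ∘ β)) + - dot y (simpleSum 𝕂 S (negPart 𝕂 ∘ β)) ≡ dot y v
  mobius-parts {v} {β} mob y = begin-equality
    dot y v⁺ + - dot y v⁻             ≡⟨ cong (_+ - dot y v⁻) (dot-congʳ y v+v⁻≡v⁺) ⟨
    dot y (λ g → v g + v⁻ g) + - dot y v⁻  ≡⟨ cong (_+ - dot y v⁻) (dot-+ʳ y v v⁻) ⟩
    dot y v + dot y v⁻ + - dot y v⁻   ≡⟨ x+y-y≡x (dot y v) (dot y v⁻) ⟩
    dot y v                           ∎
    where
    v⁺ = simpleSum 𝕂 S (posPart 𝕂 ∘ β)
    v⁻ = simpleSum 𝕂 S (negPart 𝕂 ∘ β)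
    v+v⁻≡v⁺ : ∀ g → v g + v⁻ g ≡ v⁺ g
    v+v⁻≡v⁺ g = trans (cong (_+ v⁻ g) (mob g))
      (trans (sym (∑on-+ (λ f → le f g) β (negPart 𝕂 ∘ β)))
        (∑on-cong (λ f → le f g) (λ f → x+negPart≡posPart (β f))))

  -- The integral as the value of the greedy dual solution.

  module Integral (system : IntersectionSystem S) {v : Fin m → K}
                  (capacity : Capacity 𝕂 S v) (supermodular : Supermodular 𝕂 S v) where
    consecutive = proj₁ system
    is0 = proj₁ (proj₂ system)
    is1 = proj₂ (proj₂ system)

    greedy : (Fin n → K) → Fin m → K
    greedy f = dual (run (λ _ → true) f)

    greedy-feasible : ∀ {f} → Nonneg 𝕂 f → DualFeasible 𝕂 S f (greedy f)
    greedy-feasible {f} 0≤f = dual-feasible (run (λ _ → true) f) 0≤f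

    greedy-attains : ∀ f {w} → Capacity 𝕂 S w → Supermodular 𝕂 S w → Attains f (greedy f) w
    greedy-attains f {w} cap sup
      with primal-feasible consecutive is0 is1 cap sup (run (λ _ → true) f)
    ... | 0≤x , w≤x = primal w r , (0≤x , λ g → w≤x g (λ _ _ → refl)) , strong-duality r w
      where r = run (λ _ → true) f

    -- Each term of the expansion is a supermodular capacity attained by the same `greedy f`, so
    -- `attains-∑` applies.
    greedy-attains-belief : ∀ f {β} → Nonneg 𝕂 β → Attains f (greedy f) (simpleSum 𝕂 S β)
    greedy-attains-belief f {β} 0≤β = attains-∑ (λ h g → β h when le h g)
      (λ h → greedy-attains f (ζ-capacity is1 supermodular (0≤β h) h) (ζ-supermodular is1 supermodular (0≤β h) h))

    module _ {f : Fin n → K} (0≤f : Nonneg 𝕂 f) where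

      isMinLP⁺ : ∀ β → IsMinLP 𝕂 S (simpleSum 𝕂 S (posPart 𝕂 ∘ β)) f _
      isMinLP⁺ β = isMinLP (greedy-feasible 0≤f) (greedy-attains-belief f (posPart-nonneg ∘ β))

      isMinLP⁻ : ∀ β → IsMinLP 𝕂 S (simpleSum 𝕂 S (negPart 𝕂 ∘ β)) f _
      isMinLP⁻ β = isMinLP (greedy-feasible 0≤f) (greedy-attains-belief f (negPart-nonneg ∘ β))

      greedy-isIntegral : IsIntegral 𝕂 S v f (dot (greedy f) v)
      greedy-isIntegral with mobius v
      ... | β , mob = β , mob , _ , _ , isMinLP⁺ β , isMinLP⁻ β , sym (mobius-parts mob (greedy f))

      greedy-isMax : IsMaxLP 𝕂 S v f (dot (greedy f) v)
      greedy-isMax = isMaxLP (greedy-feasible 0≤f) (greedy-attains f capacity supermodular)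

      -- `IsIntegral` leaves the expansion existential. For any choice of `β`, both minima are dual
      -- values of `greedy f`, and their difference depends on `v` alone.
      integral≡greedy : ∀ {I} → IsIntegral 𝕂 S v f I → I ≡ dot (greedy f) v
      integral≡greedy (β , mob , c⁺ , c⁻ , min⁺ , min⁻ , refl) = trans
        (cong₂ (λ s t → s + - t) (minLP-unique min⁺ (isMinLP⁺ β)) (minLP-unique min⁻ (isMinLP⁻ β)))
        (mobius-parts mob (greedy f))

    -- Primal feasibility does not involve `f`, so the same expansion and the same minimisers serve
    -- `t * f`.
    integral-scale : ∀ {t f I} → 0# ≤ t → IsIntegral 𝕂 S v f I → IsIntegral 𝕂 S v (λ a → t * f a) (t * I)
    integral-scale {t} 0≤t (β , mob , c⁺ , c⁻ , min⁺ , min⁻ , refl) =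
      β , mob , t * c⁺ , t * c⁻ , minLP-scale 0≤t min⁺ , minLP-scale 0≤t min⁻ ,
      trans (distribˡ t c⁺ (- c⁻)) (cong (t * c⁺ +_) (sym (-‿distribʳ-* t c⁻)))

    dualFeasible-+ : ∀ {f g y z} → DualFeasible 𝕂 S f y → DualFeasible 𝕂 S g z →
      DualFeasible 𝕂 S (λ a → f a + g a) (λ h → y h + z h)
    dualFeasible-+ {y = y} {z} (0≤y , y≤f) (0≤z , z≤g) =
      (λ h → +-nonneg (0≤y h) (0≤z h)) ,
      λ a → ≤-trans (≤-reflexive (∑on-+ (λ h → set h a) y z)) (+-mono₂-≤ (y≤f a) (z≤g a))

    -- The sum of the two greedy dual solutions is feasible for `f + g`, so its value is at most the
    -- maximum there.
    integral-superadditive : ∀ {f g I J L} → Nonneg 𝕂 f → Nonneg 𝕂 g →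
      IsIntegral 𝕂 S v f I → IsIntegral 𝕂 S v g J → IsIntegral 𝕂 S v (λ a → f a + g a) L → I + J ≤ L
    integral-superadditive {f} {g} {I} {J} {L} 0≤f 0≤g intI intJ intL = begin
      I + J                                        ≡⟨ cong₂ _+_ (integral≡greedy 0≤f intI) (integral≡greedy 0≤g intJ) ⟩
      dot (greedy f) v + dot (greedy g) v          ≡⟨ dot-+ˡ (greedy f) (greedy g) v ⟨
      dot (λ h → greedy f h + greedy g h) v        ≤⟨ proj₂ (greedy-isMax 0≤f+g) _
                                                        (dualFeasible-+ (greedy-feasible 0≤f) (greedy-feasible 0≤g)) ⟩
      dot (greedy (λ a → f a + g a)) v             ≡⟨ integral≡greedy 0≤f+g intL ⟨
      L                                            ∎
      where
      0≤f+g : Nonneg 𝕂 (λ a → f a + g a)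
      0≤f+g a = +-nonneg (0≤f a) (0≤g a)

theorem4 : (𝕂 : OrderedField) → let open OrderedField 𝕂 in
    (n m : ℕ) (S : OrderedSystem n m) → IntersectionSystem S →
    (v : Fin m → K) → Capacity 𝕂 S v → Supermodular 𝕂 S v →
    ((f : Fin n → K) → Nonneg 𝕂 f →
    Σ K λ I → IsIntegral 𝕂 S v f I × IsMaxLP 𝕂 S v f I)
    × ((t : K) → 0# < t → (f : Fin n → K) → Nonneg 𝕂 f → (I : K) →
    IsIntegral 𝕂 S v f I → IsIntegral 𝕂 S v (λ a → t * f a) (t * I))
    × ((f g : Fin n → K) → Nonneg 𝕂 f → Nonneg 𝕂 g → (I J L : K) →
    IsIntegral 𝕂 S v f I → IsIntegral 𝕂 S v g J →
    IsIntegral 𝕂 S v (λ a → f a + g a) L → I + J ≤ L)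
theorem4 𝕂 n m S system v capacity supermodular =
  (λ f 0≤f → _ , greedy-isIntegral 0≤f , greedy-isMax 0≤f) ,
  (λ t 0<t f _ I → integral-scale (proj₁ 0<t)) ,
  (λ f g 0≤f 0≤g I J L → integral-superadditive 0≤f 0≤g)
  where
  open Monge 𝕂 S
  open Integral system capacity supermodular
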